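{- Let $3 \leqslant m \leqslant n$ and $k\geqslant 0$ be integers. If the complete bipartite graph $K_{m,n}$ has a $B_{k}^{m}$-EPG representation (an EPG representation in which every path is monotonic and has at most $k$ bends), then $$n(2m-k-2) \leqslant k(m-1)m + \frac{1}{2}m^2 + 2(k+1)m .$$
   Context: $K_{m,n}$ is the complete bipartite graph with partition classes of sizes $m$ and $n$. A grid consists of horizontal grid lines (rows, increasing from bottom to top) and vertical grid lines (columns, increasing from left to right). A grid point is a crossing of two grid lines. A grid edge is the part of a grid line between two consecutive grid points. A path on a grid consists of two grid points (its end points) and a number of consecutive grid edges connecting them. A bend of a path is a turn of the path at a grid point. An EPG representation of a graph $G$ assigns to each vertex $v$ of $G$ a path $P_v$ on a common grid such that two distinct vertices $v,w$ are adjacent in $G$ if and only if $P_v$ and $P_w$ share at least one grid edge. A path is monotonic if it is ascending in both columns and rows, i.e. it has the shape of a staircase going upwards from left to right. In the term "$B_k^m$-EPG representation" the superscript $m$ is just a symbol for "monotonic" and is unrelated to the integer $m$. -}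

module Defs where

open import Data.Empty using (⊥)
open import Data.Fin using (Fin)
open import Data.Integer using (+_)
open import Data.List using (List; []; _∷_)
open import Data.List.Membership.Propositional using (_∈_)
open import Data.Nat using (ℕ; suc; _+_; _≤_)
open import Data.Product using (Σ-syntax; ∃-syntax; _×_; _,_)
open import Data.Rational.Unnormalised using (ℚᵘ; _/_)
open import Data.Sum using (_⊎_; inj₁; inj₂)
open import Data.Unit using (⊤)
open import Function.Bundles using (_⇔_)
open import Relation.Binary.Definitions using (Irreflexive; Symmetric)
open import Relation.Binary.PropositionalEquality using (_≡_; _≢_)

record Graph : Set₁ where
  field
    Vertex : Set
    Adj    : Vertex → Vertex → Set
    symm   : Symmetric Adj
    irrefl : Irreflexive _≡_ Adj

data BipartiteAdj {m n : ℕ} : Fin m ⊎ Fin n → Fin m ⊎ Fin n → Set where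
  left-right : ∀ {i j} → BipartiteAdj (inj₁ i) (inj₂ j)
  right-left : ∀ {i j} → BipartiteAdj (inj₂ j) (inj₁ i)

K : ℕ → ℕ → Graph
K m n = record
  { Vertex = Fin m ⊎ Fin n
  ; Adj    = BipartiteAdj
  ; symm   = λ { left-right → right-left ; right-left → left-right }
  ; irrefl = λ { {inj₁ _} {inj₁ _} _ () ; {inj₂ _} {inj₂ _} _ () }
  }

-- (column , row).  The grid lines are numbered by ℕ; every grid with finitely
-- many lines is a part of this one.
GridPoint : Set
GridPoint = ℕ × ℕ

data Orientation : Set where
  horizontal vertical : Orientation

-- Grid edges are undirected: (o , p) is the edge of orientation o whose left
-- (for horizontal) or lower (for vertical) end is p.
GridEdge : Set
GridEdge = Orientation × GridPoint

-- A traversal of one grid edge from one end to the other.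
data Step : GridPoint → GridPoint → Set where
  right : ∀ {x y} → Step (x , y) (suc x , y)
  left  : ∀ {x y} → Step (suc x , y) (x , y)
  up    : ∀ {x y} → Step (x , y) (x , suc y)
  down  : ∀ {x y} → Step (x , suc y) (x , y)

edge : ∀ {p q} → Step p q → GridEdge
edge (right {x} {y}) = horizontal , (x , y)
edge (left  {x} {y}) = horizontal , (x , y)
edge (up    {x} {y}) = vertical   , (x , y)
edge (down  {x} {y}) = vertical   , (x , y)

-- The path is listed from its end point p to its end point q.  Repeated points
-- are not excluded; a monotonic path has none.
data Path : GridPoint → GridPoint → Set where
  []  : ∀ {p} → Path p p
  _∷_ : ∀ {p q r} → Step p q → Path q r → Path p r

GridPath : Set
GridPath = ∃[ p ] ∃[ q ] Path p q

edges : ∀ {p q} → Path p q → List GridEdge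
edges []       = []
edges (s ∷ ss) = edge s ∷ edges ss

turn : Orientation → Orientation → ℕ
turn horizontal horizontal = 0
turn horizontal vertical   = 1
turn vertical   horizontal = 1
turn vertical   vertical   = 0

orientation : ∀ {p q} → Step p q → Orientation
orientation right = horizontal
orientation left  = horizontal
orientation up    = vertical
orientation down  = vertical

bends : ∀ {p q} → Path p q → ℕ
bends []           = 0
bends (s ∷ [])     = 0
bends (s ∷ t ∷ ss) = turn (orientation s) (orientation t) + bends (t ∷ ss)

AscendingStep : ∀ {p q} → Step p q → Set
AscendingStep right = ⊤
AscendingStep up    = ⊤
AscendingStep left  = ⊥
AscendingStep down  = ⊥

Ascending : ∀ {p q} → Path p q → Set
Ascending []       = ⊤
Ascending (s ∷ ss) = AscendingStep s × Ascending ss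

-- Which end point a path is listed from carries no geometric content, so a
-- staircase is taken to be listed from its lower left end.
Monotonic : GridPath → Set
Monotonic (_ , _ , P) = Ascending P

#bends : GridPath → ℕ
#bends (_ , _ , P) = bends P

_∈ᴱ_ : GridEdge → GridPath → Set
e ∈ᴱ (_ , _ , P) = e ∈ edges P

ShareEdge : GridPath → GridPath → Set
ShareEdge P Q = ∃[ e ] (e ∈ᴱ P × e ∈ᴱ Q)

record EPGRepresentation (G : Graph) : Set where
  open Graph G
  field
    path     : Vertex → GridPath
    adjacent : ∀ v w → v ≢ w → Adj v w ⇔ ShareEdge (path v) (path w)

HasMonotonicEPG : ℕ → Graph → Set
HasMonotonicEPG k G =
  Σ[ R ∈ EPGRepresentation G ]
    (∀ v → let P = EPGRepresentation.path R v in Monotonic P × #bends P ≤ k)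

fromℕ : ℕ → ℚᵘ
fromℕ a = + a / 1

{-# OPTIONS --safe #-}

-- Each of the n paths B of the larger class meets all m paths A of the smaller one,
-- so the maximal parts that it shares with the A's have at least 2m - 2 ends besides
-- the two outermost.  Charge every end to what causes it there: a bend of B (at most
-- nk in total), an end of a maximal straight part of some A (at most 2(k + 1)m, the
-- shared edges being distinct), or, if B bends from one A to another and both of
-- these go straight on, a crossing of two A's, which is used by at most two B's.
-- A monotonic path crosses every grid line at most once, so two A's have at most
-- k + 1 crossings; there are at most k if both start in the same direction, since
-- then the first part of one of them, the lower or the more left one, is not crossed.
-- At most m²/4 pairs start in different directions.

module Submission where

open import Data.Fin using (Fin)
import Data.Fin.Properties as Fin
open import Data.List using (List; []; _∷_; _++_; length; map; filter; concatMap; allFin; lookup)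
open import Data.List.Membership.Propositional using (_∈_; _∉_)
open import Data.List.Membership.Propositional.Properties
  using (∈-map⁺; ∈-map⁻; ∈-filter⁺; ∈-filter⁻; ∈-++⁺ˡ; ∈-++⁺ʳ; ∈-lookup; ∈-allFin)
open import Data.List.Properties
  using (filter-++; length-++; length-map; filter-notAll; length-tabulate)
open import Data.List.Relation.Unary.All as All using ([]; _∷_)
import Data.List.Relation.Unary.All.Properties as All
open import Data.List.Relation.Unary.AllPairs as AllPairs using ([]; _∷_)
import Data.List.Relation.Unary.AllPairs.Properties as AllPairs
open import Data.List.Relation.Unary.Any as Any using (here; there; index)
open import Data.List.Relation.Unary.Any.Properties using (lookup-index)
open import Data.List.Relation.Unary.Unique.Propositional using (Unique)
import Data.List.Relation.Unary.Unique.Propositional.Properties as Unique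
open import Data.Nat using (ℕ; suc; _≤_; s≤s; z≤n)
open import Data.Product using (∃-syntax; _×_; _,_; proj₁; proj₂)
open import Data.Product.Properties using (≡-dec)
open import Data.Sum using (_⊎_; inj₁; inj₂)
open import Function using (_∘_; _∘′_)
open import Function.Bundles using (Equivalence)
open import Relation.Binary.Definitions using (DecidableEquality)
open import Relation.Binary.PropositionalEquality
open import Relation.Nullary using (Dec; yes; no; ¬?; contradiction; _×-dec_)
open import Relation.Unary using (Decidable)
open import Defs

module _ where
  open import Data.Nat using (_+_; _*_; _∸_; _<_; _≟_)
  open import Data.Nat.ListAction using (sum)
  open import Data.Nat.Properties hiding (_≟_)
  open import Data.Nat.Tactic.RingSolver using (solve-∀)

  private variable
    X Y : Set

  -- Counting and finite covers

  lookup-injective : ∀ {xs : List X} → Unique xs →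
    ∀ {i j} → lookup xs i ≡ lookup xs j → i ≡ j
  lookup-injective (_ ∷ _)  {Fin.zero}  {Fin.zero}  _  = refl
  lookup-injective (x∉ ∷ _) {Fin.zero}  {Fin.suc j} eq = contradiction eq (All.lookup x∉ (∈-lookup j))
  lookup-injective (x∉ ∷ _) {Fin.suc i} {Fin.zero}  eq = contradiction (sym eq) (All.lookup x∉ (∈-lookup i))
  lookup-injective (_ ∷ u)  {Fin.suc i} {Fin.suc j} eq = cong Fin.suc (lookup-injective u eq)

  unique-⊆⇒length≤ : ∀ {xs ys : List X} → Unique xs → (∀ {x} → x ∈ xs → x ∈ ys) →
    length xs ≤ length ys
  unique-⊆⇒length≤ {xs = xs} {ys} unique sub = Fin.injective⇒≤ {f = position} λ {i} {j} eq →
    lookup-injective unique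
      (trans (lookup-index (sub (∈-lookup i)))
        (trans (cong (lookup ys) eq) (sym (lookup-index (sub (∈-lookup j))))))
    where
    position : Fin (length xs) → Fin (length ys)
    position i = index (sub (∈-lookup i))

  unique-map : ∀ {f : X → Y} {xs} → (∀ {x y} → x ∈ xs → y ∈ xs → f x ≡ f y → x ≡ y) →
    Unique xs → Unique (map f xs)
  unique-map inj []       = []
  unique-map inj (x∉ ∷ u) =
    All.map⁺ (All.tabulate λ y∈ eq → All.lookup x∉ y∈ (inj (here refl) (there y∈) eq)) ∷
    unique-map (λ x∈ y∈ → inj (there x∈) (there y∈)) u

  unique-concatMap : ∀ {n} {f : Fin n → List X} → (∀ j → Unique (f j)) →
    (∀ {i j x} → x ∈ f i → x ∈ f j → i ≡ j) → Unique (concatMap f (allFin n))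
  unique-concatMap {n = n} {f} unique disjoint = Unique.concat⁺
    (All.map⁺ (All.tabulate λ {j} _ → unique j))
    (AllPairs.map⁺ (AllPairs.map (λ i≢j {_} (x∈fi , x∈fj) → i≢j (disjoint x∈fi x∈fj))
      (Unique.allFin⁺ n)))

  bit : Dec X → ℕ
  bit (yes _) = 1
  bit (no  _) = 0

  bit≤1 : (d : Dec X) → bit d ≤ 1
  bit≤1 (yes _) = ≤-refl
  bit≤1 (no  _) = z≤n

  -- A payment is a right-nested sum of bits: `earn` takes one unit from its first summand, `skip`
  -- takes none.
  earn : (d : Dec X) → X → ∀ {i j} → i ≤ j → suc i ≤ bit d + j
  earn (yes _) _ i≤j = s≤s i≤j
  earn (no ¬x) x _   = contradiction x ¬x

  skip : (d : Dec X) → ∀ {i j} → i ≤ j → i ≤ bit d + j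
  skip d = m≤n⇒m≤o+n (bit d)

  count : {P : X → Set} → Decidable P → List X → ℕ
  count P? xs = length (filter P? xs)

  module _ {P : X → Set} (P? : Decidable P) where

    count-∷ : ∀ x xs → count P? (x ∷ xs) ≡ bit (P? x) + count P? xs
    count-∷ x xs with P? x
    ... | yes _ = refl
    ... | no  _ = refl

    count-++ : ∀ xs ys → count P? (xs ++ ys) ≡ count P? xs + count P? ys
    count-++ xs ys = trans (cong length (filter-++ P? xs ys)) (length-++ (filter P? xs))

    count≤count-∷ : ∀ x xs → count P? xs ≤ count P? (x ∷ xs)
    count≤count-∷ x xs rewrite count-∷ x xs = m≤n+m _ (bit (P? x))

  -- A cardinality bound that needs no enumeration: `L` may repeat elements and contain more than
  -- those satisfying `P`.
  Covered : ℕ → (X → Set) → Set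
  Covered {X} c P = ∃[ L ] (length L ≤ c × (∀ {x : X} → P x → x ∈ L))

  covered-mono : ∀ {P : X → Set} {c d} → c ≤ d → Covered c P → Covered d P
  covered-mono c≤d (L , L≤ , covers) = L , ≤-trans L≤ c≤d , covers

  count≤cover : ∀ {P : X → Set} (P? : Decidable P) {c xs} →
    Unique xs → Covered c P → count P? xs ≤ c
  count≤cover P? {xs = xs} unique (L , L≤c , cover) = ≤-trans
    (unique-⊆⇒length≤ (Unique.filter⁺ P? unique) (cover ∘ proj₂ ∘ ∈-filter⁻ P? {xs = xs})) L≤c

  covered-⋃ : ∀ {P : Y → X → Set} {c : Y → ℕ} → (∀ y → Covered (c y) (P y)) →
    ∀ ys → Covered (sum (map c ys)) (λ x → ∃[ y ] (y ∈ ys × P y x))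
  covered-⋃ cov []       = [] , z≤n , λ ()
  covered-⋃ cov (y ∷ ys) with cov y | covered-⋃ cov ys
  ... | L , L≤ , L-covers | L′ , L′≤ , L′-covers =
    L ++ L′ ,
    ≤-trans (≤-reflexive (length-++ L)) (+-mono-≤ L≤ L′≤) ,
    λ { (_ , here refl , Px) → ∈-++⁺ˡ (L-covers Px)
      ; (z , there z∈ , Px)  → ∈-++⁺ʳ L (L′-covers (z , z∈ , Px)) }

  sum-const : ∀ c (xs : List X) → sum (map (λ _ → c) xs) ≡ length xs * c
  sum-const c []       = refl
  sum-const c (_ ∷ xs) = cong (c +_) (sum-const c xs)

  sum-mono : ∀ {f g : X → ℕ} → (∀ x → f x ≤ g x) → ∀ xs → sum (map f xs) ≤ sum (map g xs)
  sum-mono f≤g []       = z≤n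
  sum-mono f≤g (x ∷ xs) = +-mono-≤ (f≤g x) (sum-mono f≤g xs)

  sum-const-+ : ∀ c (f : X → ℕ) xs → sum (map (λ x → c + f x) xs) ≡ length xs * c + sum (map f xs)
  sum-const-+ c f []       = refl
  sum-const-+ c f (x ∷ xs) rewrite sum-const-+ c f xs = interchange c (f x) (length xs * c) _
    where
    interchange : ∀ a b c d → (a + b) + (c + d) ≡ (a + c) + (b + d)
    interchange = solve-∀

  sum-filter : ∀ {P : X → Set} (P? : Decidable P) (f : X → ℕ) xs →
    sum (map f (filter P? xs)) ≤ sum (map f xs)
  sum-filter P? f []       = z≤n
  sum-filter P? f (x ∷ xs) with P? x
  ... | yes _ = +-monoʳ-≤ (f x) (sum-filter P? f xs)
  ... | no  _ = ≤-trans (sum-filter P? f xs) (m≤n+m _ (f x))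

  length-allFin : ∀ n → length (allFin n) ≡ n
  length-allFin n = length-tabulate {n = n} (λ i → i)

  -- Staircases

  perp : Orientation → Orientation
  perp horizontal = vertical
  perp vertical   = horizontal

  _≟ᴼ_ : DecidableEquality Orientation
  horizontal ≟ᴼ horizontal = yes refl
  horizontal ≟ᴼ vertical   = no λ ()
  vertical   ≟ᴼ horizontal = no λ ()
  vertical   ≟ᴼ vertical   = yes refl

  _≟ᴱ_ : DecidableEquality GridEdge
  _≟ᴱ_ = ≡-dec _≟ᴼ_ (≡-dec _≟_ _≟_)

  open import Data.List.Membership.DecPropositional _≟ᴱ_ using (_∈?_)

  same-or-perp : ∀ o o′ → o′ ≡ o ⊎ o′ ≡ perp o
  same-or-perp horizontal horizontal = inj₁ refl
  same-or-perp horizontal vertical   = inj₂ refl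
  same-or-perp vertical   horizontal = inj₂ refl
  same-or-perp vertical   vertical   = inj₁ refl

  turn-same : ∀ o → turn o o ≡ 0
  turn-same horizontal = refl
  turn-same vertical   = refl

  turn-perp : ∀ o → turn o (perp o) ≡ 1
  turn-perp horizontal = refl
  turn-perp vertical   = refl

  forward : Orientation → GridPoint → GridPoint
  forward horizontal (x , y) = suc x , y
  forward vertical   (x , y) = x , suc y

  across along : Orientation → GridPoint → ℕ
  across horizontal = proj₂
  across vertical   = proj₁
  along  horizontal = proj₁
  along  vertical   = proj₂

  along-perp : ∀ o p → along (perp o) p ≡ across o p
  along-perp horizontal p = refl
  along-perp vertical   p = refl

  along-forward : ∀ o p → along o (forward o p) ≡ suc (along o p)
  along-forward horizontal p = refl
  along-forward vertical   p = refl

  across-forward : ∀ o p → across o (forward o p) ≡ across o p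
  across-forward horizontal p = refl
  across-forward vertical   p = refl

  along≤along-forward : ∀ o o′ p → along o p ≤ along o (forward o′ p)
  along≤along-forward horizontal horizontal p = n≤1+n _
  along≤along-forward horizontal vertical   p = ≤-refl
  along≤along-forward vertical   horizontal p = ≤-refl
  along≤along-forward vertical   vertical   p = n≤1+n _

  forward-injective : ∀ o {p q} → forward o p ≡ forward o q → p ≡ q
  forward-injective horizontal refl = refl
  forward-injective vertical   refl = refl

  next : GridEdge → GridEdge
  next (o , p) = o , forward o p

  next-injective : ∀ {d e} → next d ≡ next e → d ≡ e
  next-injective {o , p} {o′ , q} eq with cong proj₁ eq
  ... | refl = cong (o ,_) (forward-injective o (cong proj₂ eq))

  perpᴱ : GridEdge → GridEdge
  perpᴱ (o , p) = perp o , p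

  perpᴱ-involutive : ∀ e → perpᴱ (perpᴱ e) ≡ e
  perpᴱ-involutive (horizontal , p) = refl
  perpᴱ-involutive (vertical   , p) = refl

  line : GridEdge → Orientation × ℕ
  line (o , p) = o , across o p

  edgesFrom : GridPoint → List Orientation → List GridEdge
  edgesFrom p []       = []
  edgesFrom p (o ∷ os) = (o , p) ∷ edgesFrom (forward o p) os

  turns : List Orientation → ℕ
  turns []            = 0
  turns (_ ∷ [])      = 0
  turns (o ∷ o′ ∷ os) = turn o o′ + turns (o′ ∷ os)

  -- The first step is kept apart: it makes the staircase nonempty, and its direction and line
  -- matter for counting crossings.
  record Staircase : Set where
    constructor staircase
    field
      start : GridPoint
      first : Orientation
      rest  : List Orientation

  open Staircase

  #turns : Staircase → ℕ
  #turns S = turns (first S ∷ rest S)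

  -- An element (o , p) of nextEdges S says that S enters p in direction o.
  edgesOf nextEdges : Staircase → List GridEdge
  edgesOf S   = edgesFrom (start S) (first S ∷ rest S)
  nextEdges S = map next (edgesOf S)

  start-≤ : ∀ {p os o q} → (o , q) ∈ edgesFrom p os → ∀ o′ → along o′ p ≤ along o′ q
  start-≤ {os = _ ∷ _} (here refl) o′ = ≤-refl
  start-≤ {p} {o ∷ _}  (there q∈)  o′ = ≤-trans (along≤along-forward o′ o p) (start-≤ q∈ o′)

  start-< : ∀ {p o os o′ q} → (o′ , q) ∈ edgesFrom (forward o p) os → along o p < along o q
  start-< {p} {o} q∈ = ≤-trans (≤-reflexive (sym (along-forward o p))) (start-≤ q∈ o)

  edgesFrom-unique : ∀ p os → Unique (edgesFrom p os)
  edgesFrom-unique p []       = []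
  edgesFrom-unique p (o ∷ os) =
    All.tabulate (λ { e∈ refl → <-irrefl refl (start-< e∈) }) ∷ edgesFrom-unique (forward o p) os

  -- A step in direction `o` raises `along o`, and no step lowers it.
  parallel-injective : ∀ {p os o q r} → (o , q) ∈ edgesFrom p os → (o , r) ∈ edgesFrom p os →
    along o q ≡ along o r → q ≡ r
  parallel-injective {os = _ ∷ _} (here refl) (here refl) _  = refl
  parallel-injective {os = _ ∷ _} (here refl) (there r∈)  eq = contradiction eq (<⇒≢ (start-< r∈))
  parallel-injective {os = _ ∷ _} (there q∈)  (here refl) eq = contradiction (sym eq) (<⇒≢ (start-< q∈))
  parallel-injective {os = _ ∷ _} (there q∈)  (there r∈)  eq = parallel-injective q∈ r∈ eq

  -- Each of the following covers has one element for each maximal straight part.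

  ends-covered : ∀ p o os → Covered (suc (turns (o ∷ os)))
    (λ u → u ∈ map next (edgesFrom p (o ∷ os)) × u ∉ edgesFrom p (o ∷ os))
  ends-covered p o []        = next (o , p) ∷ [] , ≤-refl , λ { (here refl , _) → here refl }
  ends-covered p o (o′ ∷ os) with ends-covered (forward o p) o′ os | same-or-perp o o′
  ... | L , L≤ , covers | inj₁ refl rewrite turn-same o =
    L , L≤ , λ { (here refl , u∉) → contradiction (there (here refl)) u∉
               ; (there u∈  , u∉) → covers (u∈ , u∉ ∘ there) }
  ... | L , L≤ , covers | inj₂ refl rewrite turn-perp o =
    next (o , p) ∷ L , s≤s L≤ , λ { (here refl , _) → here refl
                                  ; (there u∈ , u∉) → there (covers (u∈ , u∉ ∘ there)) }

  later-starts-covered : ∀ p o os → Covered (turns (o ∷ os))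
    (λ t → t ∈ edgesFrom (forward o p) os × t ∉ map next (edgesFrom p (o ∷ os)))
  later-starts-covered p o []        = [] , z≤n , λ ()
  later-starts-covered p o (o′ ∷ os) with later-starts-covered (forward o p) o′ os | same-or-perp o o′
  ... | L , L≤ , covers | inj₁ refl rewrite turn-same o =
    L , L≤ , λ { (here refl , t∉) → contradiction (here refl) t∉
               ; (there t∈  , t∉) → covers (t∈ , t∉ ∘ there) }
  ... | L , L≤ , covers | inj₂ refl rewrite turn-perp o =
    (o′ , forward o p) ∷ L , s≤s L≤ , λ { (here refl , _) → here refl
                                        ; (there t∈ , t∉) → there (covers (t∈ , t∉ ∘ there)) }

  starts-covered : ∀ S → Covered (suc (#turns S)) (λ t → t ∈ edgesOf S × t ∉ nextEdges S)
  starts-covered (staircase p o os) with later-starts-covered p o os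
  ... | L , L≤ , covers = (o , p) ∷ L , s≤s L≤ , λ { (here refl , _) → here refl
                                                   ; (there t∈ , t∉) → there (covers (t∈ , t∉)) }

  later-lines : ∀ p o os → ∃[ L ] (length L ≤ turns (o ∷ os) ×
    (∀ {e} → e ∈ edgesFrom p (o ∷ os) → line e ∈ line (o , p) ∷ L))
  later-lines p o []        = [] , z≤n , λ { (here refl) → here refl }
  later-lines p o (o′ ∷ os) with later-lines (forward o p) o′ os | same-or-perp o o′
  ... | L , L≤ , covers | inj₁ refl rewrite turn-same o | across-forward o p =
    L , L≤ , λ { (here refl) → here refl ; (there e∈) → covers e∈ }
  ... | L , L≤ , covers | inj₂ refl rewrite turn-perp o =
    line (o′ , forward o p) ∷ L , s≤s L≤ , λ { (here refl) → here refl ; (there e∈) → there (covers e∈) }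

  -- Crossings

  -- With `u = (o , p)`, the staircase enters and leaves `p` in direction `o`: it goes straight on
  -- there.
  Passes : Staircase → GridEdge → Set
  Passes S u = u ∈ edgesOf S × u ∈ nextEdges S

  passes? : ∀ S → Decidable (Passes S)
  passes? S u = u ∈? edgesOf S ×-dec u ∈? nextEdges S

  -- The direction of `u` is that of `S`, so a crossing point yields `u` for the pair `S`, `T` and
  -- `perpᴱ u` for `T`, `S`.
  Crossing : Staircase → Staircase → GridEdge → Set
  Crossing S T u = Passes S u × Passes T (perpᴱ u)

  crossing? : ∀ S T → Decidable (Crossing S T)
  crossing? S T u = passes? S u ×-dec passes? T (perpᴱ u)

  crossing-sym : ∀ S T {u} → Crossing S T u → Crossing T S (perpᴱ u)
  crossing-sym S T {u} (S-passes , T-passes) =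
    T-passes , subst (Passes S) (sym (perpᴱ-involutive u)) S-passes

  -- A monotonic path crosses every grid line at most once.
  crossing-line-injective : ∀ S T {u v} → Crossing S T u → Crossing S T v → line u ≡ line v → u ≡ v
  crossing-line-injective S T {o , p} {o′ , q} (_ , u∈T , _) (_ , v∈T , _) eq with cong proj₁ eq
  ... | refl = cong (o ,_) (parallel-injective u∈T v∈T
    (trans (along-perp o p) (trans (cong proj₂ eq) (sym (along-perp o q)))))

  -- `line` is injective on crossings, which are edges of `S`, so there are at most as many of them
  -- as lines in `L`.
  crossings-covered-by-lines : ∀ S T {c} (L : List (Orientation × ℕ)) → length L ≤ c →
    (∀ {u} → Crossing S T u → line u ∈ L) → Covered c (Crossing S T)
  crossings-covered-by-lines S T L L≤ covers =
    crossings ,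
    ≤-trans (≤-reflexive (sym (length-map line crossings)))
      (≤-trans (unique-⊆⇒length≤ lines-unique line∈L) L≤) ,
    λ cross → ∈-filter⁺ (crossing? S T) (proj₁ (proj₁ cross)) cross
    where
    crossings = filter (crossing? S T) (edgesOf S)

    is-crossing : ∀ {u} → u ∈ crossings → Crossing S T u
    is-crossing u∈ = proj₂ (∈-filter⁻ (crossing? S T) {xs = edgesOf S} u∈)

    lines-unique = unique-map
      (λ u∈ v∈ → crossing-line-injective S T (is-crossing u∈) (is-crossing v∈))
      (Unique.filter⁺ (crossing? S T) (edgesFrom-unique (start S) (first S ∷ rest S)))

    line∈L : ∀ {l} → l ∈ map line crossings → l ∈ L
    line∈L l∈ with ∈-map⁻ line l∈
    ... | u , u∈ , refl = covers (is-crossing u∈)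

  -- To cross the first line of `S`, `T` must enter it by a perpendicular edge from one unit before
  -- it; but `T` starts level with it or beyond, and coordinates never decrease.
  first-line-not-crossed : ∀ S T {u} → first S ≡ first T →
    across (first S) (start S) ≤ across (first S) (start T) →
    Crossing S T u → line u ≢ line (first S , start S)
  first-line-not-crossed (staircase p o os) (staircase q _ os′) {o′ , r} refl below (_ , _ , r∈) eq
    with cong proj₁ eq
  ... | refl with ∈-map⁻ next r∈
  ... | (_ , r′) , r′∈ , refl = <-irrefl refl (begin-strict
    across o r                          ≡⟨ cong proj₂ eq ⟩
    across o p                          ≤⟨ below ⟩
    across o q                          ≡⟨ along-perp o q ⟨
    along (perp o) q                    ≤⟨ start-≤ r′∈ (perp o) ⟩
    along (perp o) r′                   <⟨ ≤-reflexive (sym (along-forward (perp o) r′)) ⟩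
    along (perp o) r                    ≡⟨ along-perp o r ⟩
    across o r                          ∎)
    where open ≤-Reasoning

  crossings-covered-below : ∀ S T → first S ≡ first T →
    across (first S) (start S) ≤ across (first S) (start T) → Covered (#turns S) (Crossing S T)
  crossings-covered-below S T same below with later-lines (start S) (first S) (rest S)
  ... | L , L≤ , covers = crossings-covered-by-lines S T L L≤ in-L
    where
    in-L : ∀ {u} → Crossing S T u → line u ∈ L
    in-L cross with covers (proj₁ (proj₁ cross))
    ... | here eq  = contradiction eq (first-line-not-crossed S T same below cross)
    ... | there l∈ = l∈

  -- `turn` is 1 just when the first directions differ; then all lines of `S` are allowed. Otherwise
  -- the staircase that does not start beyond the other loses its first line.
  crossings-covered : ∀ S T {k} → #turns S ≤ k → #turns T ≤ k →
    Covered (k + turn (first S) (first T)) (Crossing S T)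
  crossings-covered S T {k} S≤ T≤ with same-or-perp (first S) (first T)
  ... | inj₂ opposite with later-lines (start S) (first S) (rest S)
  ...   | L , L≤ , covers =
    covered-mono bound (crossings-covered-by-lines S T _ (s≤s L≤) (covers ∘ proj₁ ∘ proj₁))
    where
    open ≤-Reasoning
    bound : suc (#turns S) ≤ k + turn (first S) (first T)
    bound = begin
      suc (#turns S)                      ≤⟨ s≤s S≤ ⟩
      suc k                               ≡⟨ +-comm 1 k ⟩
      k + 1                               ≡⟨ cong (k +_) (turn-perp (first S)) ⟨
      k + turn (first S) (perp (first S)) ≡⟨ cong (λ o → k + turn (first S) o) opposite ⟨
      k + turn (first S) (first T)        ∎
  crossings-covered S T {k} S≤ T≤ | inj₁ same
    with ≤-total (across (first S) (start S)) (across (first S) (start T))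
  ... | inj₁ below = covered-mono (≤-trans S≤ (m≤m+n k _)) (crossings-covered-below S T (sym same) below)
  -- Now `T` takes the role of `S`, and `perpᴱ` turns its crossings back.
  ... | inj₂ above
    with crossings-covered-below T S same (subst (λ o → across o _ ≤ across o _) (sym same) above)
  ...   | L , L≤ , covers =
    map perpᴱ L ,
    ≤-trans (≤-reflexive (length-map perpᴱ L)) (≤-trans L≤ (≤-trans T≤ (m≤m+n k _))) ,
    λ {u} cross → subst (_∈ map perpᴱ L) (perpᴱ-involutive u)
      (∈-map⁺ perpᴱ (covers (crossing-sym S T cross)))

  -- One step of `runs`: the bound for the rest uses the bit `u` of the next edge, which the
  -- transition trades for the bit `s` of the present one; `d` is 2 if a run closes, else 0.
  add-payment : ∀ u s be bs bc t e st c r {d y} → d + u ≤ s + (be + (bs + (bc + t))) →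
    y ≤ suc (u + (e + (st + (c + r)))) →
    d + y ≤ suc (s + ((be + e) + ((bs + st) + ((bc + c) + (t + r)))))
  add-payment u s be bs bc t e st c r {d} {y} paid y≤ = begin
    d + y                                                     ≤⟨ +-monoʳ-≤ d y≤ ⟩
    d + suc (u + (e + (st + (c + r))))                        ≡⟨ shuffle₁ d u (e + (st + (c + r))) ⟩
    suc ((d + u) + (e + (st + (c + r))))                      ≤⟨ s≤s (+-monoˡ-≤ _ paid) ⟩
    suc ((s + (be + (bs + (bc + t)))) + (e + (st + (c + r)))) ≡⟨ shuffle₂ s be bs bc t e st c r ⟩
    suc (s + ((be + e) + ((bs + st) + ((bc + c) + (t + r))))) ∎
    where
    open ≤-Reasoning
    shuffle₁ : ∀ d u z → d + suc (u + z) ≡ suc ((d + u) + z)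
    shuffle₁ = solve-∀
    shuffle₂ : ∀ s be bs bc t e st c r →
      suc ((s + (be + (bs + (bc + t)))) + (e + (st + (c + r)))) ≡
      suc (s + ((be + e) + ((bs + st) + ((bc + c) + (t + r)))))
    shuffle₂ = solve-∀

  -- The walk along a path that meets the members of a disjoint family

  module Walk {m} (A : Fin m → Staircase)
    (disjoint : ∀ {a b e} → e ∈ edgesOf (A a) → e ∈ edgesOf (A b) → a ≡ b) where

    -- With `u = (o , p)`, `End u` says that a member enters `p` in direction `o` without going
    -- straight on; `Start` is the mirror image.
    Used End Start Cross : GridEdge → Set
    Used e  = ∃[ a ] e ∈ edgesOf (A a)
    End u   = ∃[ a ] (u ∈ nextEdges (A a) × u ∉ edgesOf (A a))
    Start t = ∃[ a ] (t ∈ edgesOf (A a) × t ∉ nextEdges (A a))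
    Cross u = ∃[ a ] ∃[ b ] (a ≢ b × Crossing (A a) (A b) u)

    abstract
      used? : Decidable Used
      used? e = Fin.any? λ a → e ∈? edgesOf (A a)

      end? : Decidable End
      end? u = Fin.any? λ a → u ∈? nextEdges (A a) ×-dec ¬? (u ∈? edgesOf (A a))

      start? : Decidable Start
      start? t = Fin.any? λ a → t ∈? edgesOf (A a) ×-dec ¬? (t ∈? nextEdges (A a))

      cross? : Decidable Cross
      cross? u = Fin.any? λ a → Fin.any? λ b → ¬? (a Fin.≟ b) ×-dec crossing? (A a) (A b) u

    next∈⇒∈ : ∀ S {e} → next e ∈ nextEdges S → e ∈ edgesOf S
    next∈⇒∈ S next∈ with ∈-map⁻ next next∈
    ... | d , d∈ , eq with next-injective eq
    ... | refl = d∈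

    -- The passage from an edge s to the following edge t pays for both ends that
    -- the runs of s and t have between them.
    transition : ∀ p o o′ →
      let s = o , p ; u = next s ; t = o′ , forward o p
          paid = bit (end? u) + (bit (start? t) + (bit (cross? u) + turn o o′))
      in ((∀ {a} → s ∈ edgesOf (A a) → t ∈ edgesOf (A a)) ×
           bit (used? t) ≤ bit (used? s) + paid)
         ⊎ (Used s × 2 + bit (used? t) ≤ bit (used? s) + paid)
    transition p o o′ with used? (o , p)
    transition p o o′ | no s∉ = inj₁ ((λ s∈a → contradiction (_ , s∈a) s∉) , bound)
      where
      u = next (o , p)
      t = o′ , forward o p

      bound : bit (used? t) ≤ bit (end? u) + (bit (start? t) + (bit (cross? u) + turn o o′))
      bound with used? t
      ... | no _ = z≤n
      -- On a straight passage `A b` starts at `t`, since otherwise it would contain `s`; at a turn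
      -- the bend pays.
      ... | yes (b , t∈b) with same-or-perp o o′
      ...   | inj₁ refl = skip (end? u) (earn (start? t)
                (b , t∈b , λ t∈Nb → s∉ (b , next∈⇒∈ (A b) t∈Nb)) z≤n)
      ...   | inj₂ refl = skip (end? u) (skip (start? t) (skip (cross? u)
                (≤-reflexive (sym (turn-perp o)))))
    transition p o o′ | yes (a , s∈a) with (o′ , forward o p) ∈? edgesOf (A a)
    -- The run continues, and the unit of `s` becomes that of `t`.
    ... | yes t∈a = inj₁
      ( (λ s∈b → subst (λ c → _ ∈ edgesOf (A c)) (disjoint s∈a s∈b) t∈a)
      , ≤-trans (bit≤1 (used? (o′ , forward o p))) (s≤s z≤n))
    ... | no t∉a = inj₂ ((a , s∈a) , s≤s bound)
      where
      u = next (o , p)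
      t = o′ , forward o p

      a≢ : ∀ {b} → t ∈ edgesOf (A b) → a ≢ b
      a≢ t∈b refl = t∉a t∈b

      u∈Na : u ∈ nextEdges (A a)
      u∈Na = ∈-map⁺ next s∈a

      -- The bit of `s` covers the near end of the run closing here. Left to pay are its far end
      -- and, if `t` is used, the near end of the next run.
      bound : 1 + bit (used? t) ≤ bit (end? u) + (bit (start? t) + (bit (cross? u) + turn o o′))
      bound with used? t | same-or-perp o o′
      ... | no _ | inj₁ refl = earn (end? u) (a , u∈Na , t∉a) z≤n
      ... | no _ | inj₂ refl = skip (end? u) (skip (start? t) (skip (cross? u)
                (≤-reflexive (sym (turn-perp o)))))
      ... | yes (b , t∈b) | inj₁ refl = earn (end? u) (a , u∈Na , t∉a) (earn (start? t)
                (b , t∈b , λ t∈Nb → a≢ t∈b (disjoint s∈a (next∈⇒∈ (A b) t∈Nb))) z≤n)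
      -- The bend pays one unit. The other comes from `A a` if it does not go straight on, from
      -- `A b` if it did not come straight, and otherwise from their crossing.
      ... | yes (b , t∈b) | inj₂ refl with u ∈? edgesOf (A a)
      ...   | no u∉a = earn (end? u) (a , u∈Na , u∉a) (skip (start? t) (skip (cross? u)
                (≤-reflexive (sym (turn-perp o)))))
      ...   | yes u∈a with t ∈? nextEdges (A b)
      ...     | no t∉Nb = skip (end? u) (earn (start? t) (b , t∈b , t∉Nb) (skip (cross? u)
                  (≤-reflexive (sym (turn-perp o)))))
      ...     | yes t∈Nb = skip (end? u) (skip (start? t) (earn (cross? u)
                  (a , b , a≢ t∈b , (u∈a , u∈Na) , (t∈b , t∈Nb))
                  (≤-reflexive (sym (turn-perp o)))))

    -- `R` has one entry for each run, possibly repeating a member, and each run has two ends. The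
    -- `suc` allows for the far end of the last run, the bit for the near end of a run that begins
    -- with the first edge.
    runs : ∀ p o os → ∃[ R ]
      (2 * length R ≤ suc (bit (used? (o , p)) +
         (count end? (map next (edgesFrom p (o ∷ os))) +
         (count start? (edgesFrom (forward o p) os) +
         (count cross? (map next (edgesFrom p (o ∷ os))) +
          turns (o ∷ os))))) ×
       (∀ {a e} → e ∈ edgesFrom p (o ∷ os) → e ∈ edgesOf (A a) → a ∈ R))
    runs p o [] with used? (o , p)
    ... | yes (a , e∈a) = a ∷ [] , s≤s (s≤s z≤n) , λ { (here refl) e∈b → here (disjoint e∈b e∈a) }
    ... | no  unused    = [] , z≤n , λ { (here refl) e∈b → contradiction (_ , e∈b) unused }
    runs p o (o′ ∷ os)
      rewrite count-∷ end? (next (o , p)) (map next (edgesFrom (forward o p) (o′ ∷ os)))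
            | count-∷ start? (o′ , forward o p) (edgesFrom (forward o′ (forward o p)) os)
            | count-∷ cross? (next (o , p)) (map next (edgesFrom (forward o p) (o′ ∷ os)))
      with runs (forward o p) o′ os | transition p o o′
         | add-payment (bit (used? (o′ , forward o p))) (bit (used? (o , p)))
             (bit (end? (next (o , p)))) (bit (start? (o′ , forward o p)))
             (bit (cross? (next (o , p)))) (turn o o′)
             (count end? (map next (edgesFrom (forward o p) (o′ ∷ os))))
             (count start? (edgesFrom (forward o′ (forward o p)) os))
             (count cross? (map next (edgesFrom (forward o p) (o′ ∷ os))))
             (turns (o′ ∷ os))
    ... | R , R≤ , covers | inj₁ (continues , paid) | add =
      R , add {0} paid R≤ , λ { (here refl) e∈a → covers (here refl) (continues e∈a)
                              ; (there e∈)  e∈a → covers e∈ e∈a }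
    ... | R , R≤ , covers | inj₂ ((a , s∈a) , paid) | add =
      a ∷ R , ≤-trans (≤-reflexive (*-suc 2 (length R))) (add {2} paid R≤) ,
      λ { (here refl) e∈b → here (disjoint e∈b s∈a) ; (there e∈) e∈b → there (covers e∈ e∈b) }

  -- Summation of the charges over all paths

  covered-⊆ : ∀ {P Q : X → Set} {c} → (∀ {x} → P x → Q x) → Covered c Q → Covered c P
  covered-⊆ P⊆Q (L , L≤ , covers) = L , L≤ , covers ∘′ P⊆Q

  covered-∃ : ∀ {m} {P : Fin m → X → Set} {c} → (∀ a → Covered (c a) (P a)) →
    Covered (sum (map c (allFin m))) (λ x → ∃[ a ] P a x)
  covered-∃ cov = covered-⊆ (λ (a , Pax) → a , ∈-allFin a , Pax) (covered-⋃ cov (allFin _))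

  others : ∀ {m} → Fin m → List (Fin m)
  others {m} a = filter (λ b → ¬? (a Fin.≟ b)) (allFin m)

  length-others : ∀ {m} (a : Fin m) → length (others a) ≤ m ∸ 1
  length-others {m} a = <⇒≤pred (subst (length (others a) <_) (length-allFin m)
    (filter-notAll (λ b → ¬? (a Fin.≟ b)) (allFin m) (Any.map (λ a≡b a≢b → a≢b a≡b) (∈-allFin a))))

  module _ (o : X → Orientation) where

    #turning : Orientation → List X → ℕ
    #turning o′ xs = sum (map (λ x → turn o′ (o x)) xs)

    #turning-total : ∀ xs → #turning vertical xs + #turning horizontal xs ≡ length xs
    #turning-total []       = refl
    #turning-total (x ∷ xs) with o x | #turning-total xs
    ... | horizontal | eq = cong suc eq
    ... | vertical   | eq = trans (+-suc _ _) (cong suc eq)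

    -- These are the ordered pairs of different orientations, sorted by the first entry;
    -- `#turning vertical` counts the horizontal elements.
    sum-#turning : ∀ xs ys → sum (map (λ x → #turning (o x) ys) xs) ≡
      #turning vertical xs * #turning horizontal ys + #turning horizontal xs * #turning vertical ys
    sum-#turning []       ys = refl
    sum-#turning (x ∷ xs) ys with o x | sum-#turning xs ys
    ... | horizontal | eq rewrite eq = sym (+-assoc (#turning horizontal ys) _ _)
    ... | vertical   | eq rewrite eq =
      rotate (#turning vertical ys) (#turning vertical xs * #turning horizontal ys)
        (#turning horizontal xs * #turning vertical ys)
      where
      rotate : ∀ a b c → a + (b + c) ≡ b + (a + c)
      rotate = solve-∀

  -- The two sides differ by the square of the difference of `a` and `b`.
  am-gm : ∀ a b → 2 * (a * b + b * a) ≤ (a + b) * (a + b)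
  am-gm a b with ≤-total a b
  ... | inj₁ a≤b = subst (λ b → 2 * (a * b + b * a) ≤ (a + b) * (a + b)) (m+[n∸m]≡n a≤b)
    (subst (2 * (a * (a + (b ∸ a)) + (a + (b ∸ a)) * a) ≤_) (sym (square a (b ∸ a))) (m≤m+n _ _))
    where
    square : ∀ a d → (a + (a + d)) * (a + (a + d)) ≡ 2 * (a * (a + d) + (a + d) * a) + d * d
    square = solve-∀
  ... | inj₂ b≤a = subst (λ a → 2 * (a * b + b * a) ≤ (a + b) * (a + b)) (m+[n∸m]≡n b≤a)
    (subst (2 * ((b + (a ∸ b)) * b + b * (b + (a ∸ b))) ≤_) (sym (square b (a ∸ b))) (m≤m+n _ _))
    where
    square : ∀ b d → ((b + d) + b) * ((b + d) + b) ≡ 2 * ((b + d) * b + b * (b + d)) + d * d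
    square = solve-∀

  -- The sum is over ordered pairs, so that both directions in which a path can enter a crossing are
  -- counted.
  #crossings : ∀ {m} (o : Fin m → Orientation) → ℕ → ℕ
  #crossings {m} o k =
    sum (map (λ a → sum (map (λ b → k + turn (o a) (o b)) (others a))) (allFin m))

  -- Each of the m (m - 1) ordered pairs brings k, and at most m² / 2 of them one more; the factor 2
  -- clears the fraction.
  #crossings-bound : ∀ {m} (o : Fin m → Orientation) k →
    2 * #crossings o k ≤ 2 * (m * ((m ∸ 1) * k)) + m * m
  #crossings-bound {m} o k = begin
    2 * #crossings o k
      ≤⟨ *-monoʳ-≤ 2 (sum-mono row (allFin m)) ⟩
    2 * sum (map (λ a → (m ∸ 1) * k + #turning o (o a) (allFin m)) (allFin m))
      ≡⟨ cong (2 *_) (sum-const-+ ((m ∸ 1) * k) _ (allFin m)) ⟩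
    2 * (length (allFin m) * ((m ∸ 1) * k) + sum (map (λ a → #turning o (o a) (allFin m)) (allFin m)))
      ≡⟨ cong₂ (λ i j → 2 * (i * ((m ∸ 1) * k) + j)) (length-allFin m) (sum-#turning o (allFin m) (allFin m)) ⟩
    2 * (m * ((m ∸ 1) * k) + (v * h + h * v))
      ≡⟨ *-distribˡ-+ 2 (m * ((m ∸ 1) * k)) (v * h + h * v) ⟩
    2 * (m * ((m ∸ 1) * k)) + 2 * (v * h + h * v)
      ≤⟨ +-monoʳ-≤ (2 * (m * ((m ∸ 1) * k))) (am-gm v h) ⟩
    2 * (m * ((m ∸ 1) * k)) + (v + h) * (v + h)
      ≡⟨ cong (λ i → 2 * (m * ((m ∸ 1) * k)) + i * i) (trans (#turning-total o (allFin m)) (length-allFin m)) ⟩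
    2 * (m * ((m ∸ 1) * k)) + m * m ∎
    where
    open ≤-Reasoning
    v = #turning o vertical (allFin m)
    h = #turning o horizontal (allFin m)
    row : ∀ a → sum (map (λ b → k + turn (o a) (o b)) (others a)) ≤ (m ∸ 1) * k + #turning o (o a) (allFin m)
    row a = begin
      sum (map (λ b → k + turn (o a) (o b)) (others a))
        ≡⟨ sum-const-+ k _ (others a) ⟩
      length (others a) * k + #turning o (o a) (others a)
        ≤⟨ +-mono-≤ (*-monoˡ-≤ k (length-others a))
             (sum-filter (λ b → ¬? (a Fin.≟ b)) (λ b → turn (o a) (o b)) (allFin m)) ⟩
      (m ∸ 1) * k + #turning o (o a) (allFin m) ∎

  module Total {m n k} (A : Fin m → Staircase) (B : Fin n → Staircase)
    (A-disjoint : ∀ {a b e} → e ∈ edgesOf (A a) → e ∈ edgesOf (A b) → a ≡ b)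
    (B-disjoint : ∀ {i j e} → e ∈ edgesOf (B i) → e ∈ edgesOf (B j) → i ≡ j)
    (A-turns : ∀ a → #turns (A a) ≤ k) (B-turns : ∀ j → #turns (B j) ≤ k)
    (meet : ∀ a j → ∃[ e ] (e ∈ edgesOf (A a) × e ∈ edgesOf (B j))) where

    open Walk A A-disjoint

    -- Over all indices, disjointness of the B's makes the concatenation free of repetitions, so
    -- that `count≤cover` bounds all charges at once.
    ends : List (Fin n) → ℕ
    ends js = count end? (concatMap (nextEdges ∘ B) js)

    starts : List (Fin n) → ℕ
    starts js = count start? (concatMap (edgesOf ∘ B) js)

    crosses : List (Fin n) → ℕ
    crosses js = count cross? (concatMap (nextEdges ∘ B) js)

    walk-bound : ∀ j → 2 * m ≤ (2 + k) +
      (count end? (nextEdges (B j)) + (count start? (edgesOf (B j)) + count cross? (nextEdges (B j))))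
    walk-bound j with B j | B-turns j | (λ a → meet a j)
    ... | staircase p o os | turns≤ | meets with runs p o os
    ...   | R , R≤ , covers = begin
      2 * m                                     ≤⟨ *-monoʳ-≤ 2 m≤R ⟩
      2 * length R                              ≤⟨ R≤ ⟩
      suc (bit (used? (o , p)) + (e + (s + (c + turns (o ∷ os)))))
        -- The bit, at most 1, and the `suc` are the two outermost ends. The first edge joins the
        -- starts, so that whole edge lists are counted.
        ≤⟨ s≤s (+-mono-≤ (bit≤1 (used? (o , p))) (+-monoʳ-≤ e
             (+-mono-≤ (count≤count-∷ start? (o , p) _) (+-monoʳ-≤ c turns≤)))) ⟩
      suc (1 + (e + (s′ + (c + k))))            ≡⟨ reorder e s′ c k ⟩
      (2 + k) + (e + (s′ + c))                  ∎
      where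
      open ≤-Reasoning
      e  = count end? (map next (edgesFrom p (o ∷ os)))
      s  = count start? (edgesFrom (forward o p) os)
      s′ = count start? (edgesFrom p (o ∷ os))
      c  = count cross? (map next (edgesFrom p (o ∷ os)))

      m≤R : m ≤ length R
      m≤R = subst (_≤ length R) (length-allFin m) (unique-⊆⇒length≤ (Unique.allFin⁺ m)
        (λ {a} _ → covers (proj₂ (proj₂ (meets a))) (proj₁ (proj₂ (meets a)))))

      reorder : ∀ e s c k → suc (1 + (e + (s + (c + k)))) ≡ (2 + k) + (e + (s + c))
      reorder = solve-∀

    walks-bound : ∀ js → length js * (2 * m) ≤ length js * (2 + k) + (ends js + (starts js + crosses js))
    walks-bound []       = z≤n
    walks-bound (j ∷ js)
      rewrite count-++ end? (nextEdges (B j)) (concatMap (nextEdges ∘ B) js)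
            | count-++ start? (edgesOf (B j)) (concatMap (edgesOf ∘ B) js)
            | count-++ cross? (nextEdges (B j)) (concatMap (nextEdges ∘ B) js) =
      ≤-trans (+-mono-≤ (walk-bound j) (walks-bound js))
        (≤-reflexive (regroup (2 + k) (length js * (2 + k)) (count end? (nextEdges (B j)))
          (count start? (edgesOf (B j))) (count cross? (nextEdges (B j)))
          (ends js) (starts js) (crosses js)))
      where
      regroup : ∀ x y e s c e′ s′ c′ → (x + (e + (s + c))) + (y + (e′ + (s′ + c′))) ≡
        (x + y) + ((e + e′) + ((s + s′) + (c + c′)))
      regroup = solve-∀

    edges-unique : Unique (concatMap (edgesOf ∘ B) (allFin n))
    edges-unique = unique-concatMap
      (λ j → edgesFrom-unique (start (B j)) (first (B j) ∷ rest (B j))) B-disjoint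

    -- As `next` is injective, only one B can enter a given point in a given direction.
    nextEdges-unique : Unique (concatMap (nextEdges ∘ B) (allFin n))
    nextEdges-unique = unique-concatMap
      (λ j → Unique.map⁺ next-injective (edgesFrom-unique (start (B j)) (first (B j) ∷ rest (B j))))
      next-disjoint
      where
      next-disjoint : ∀ {i j e} → e ∈ nextEdges (B i) → e ∈ nextEdges (B j) → i ≡ j
      next-disjoint {i} {j} e∈i e∈j with ∈-map⁻ next e∈i
      ... | d , d∈i , refl = B-disjoint d∈i (next∈⇒∈ (B j) e∈j)

    sum-suc-k : sum (map (λ (_ : Fin m) → suc k) (allFin m)) ≡ m * suc k
    sum-suc-k = trans (sum-const (suc k) (allFin m)) (cong (_* suc k) (length-allFin m))

    -- At most k turns leave at most k + 1 straight parts, with one end each.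
    ends≤ : ends (allFin n) ≤ m * suc k
    ends≤ = subst (ends (allFin n) ≤_) sum-suc-k (count≤cover end? nextEdges-unique
      (covered-∃ λ a → covered-mono (s≤s (A-turns a)) (ends-covered (start (A a)) (first (A a)) (rest (A a)))))

    starts≤ : starts (allFin n) ≤ m * suc k
    starts≤ = subst (starts (allFin n) ≤_) sum-suc-k (count≤cover start? edges-unique
      (covered-∃ λ a → covered-mono (s≤s (A-turns a)) (starts-covered (A a))))

    -- Two B's at the same crossing enter it in different directions, by `u` and `perpᴱ u`; these
    -- belong to the ordered pairs (a, b) and (b, a).
    crosses≤ : crosses (allFin n) ≤ #crossings (first ∘ A) k
    crosses≤ = count≤cover cross? nextEdges-unique (covered-∃ λ a →
      covered-⊆ (λ (b , a≢b , cross) → b , ∈-filter⁺ (λ b → ¬? (a Fin.≟ b)) (∈-allFin b) a≢b , cross)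
        (covered-⋃ (λ b → crossings-covered (A a) (A b) (A-turns a) (A-turns b)) (others a)))

    -- Doubling clears m² / 2, and the negative terms of the theorem are kept on the right to remain
    -- in `ℕ`.
    total-bound : 2 * (n * (2 * m)) ≤
      2 * (n * (2 + k)) + (4 * (m * suc k) + (2 * (m * ((m ∸ 1) * k)) + m * m))
    total-bound = begin
      2 * (n * (2 * m))
        ≤⟨ *-monoʳ-≤ 2 (subst (λ l → l * (2 * m) ≤ l * (2 + k) + charges)
             (length-allFin n) (walks-bound (allFin n))) ⟩
      2 * (n * (2 + k) + charges)
        ≤⟨ *-monoʳ-≤ 2 (+-monoʳ-≤ (n * (2 + k)) (+-mono-≤ ends≤ (+-mono-≤ starts≤ crosses≤))) ⟩
      2 * (n * (2 + k) + (m * suc k + (m * suc k + D)))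
        ≡⟨ double (n * (2 + k)) (m * suc k) D ⟩
      2 * (n * (2 + k)) + (4 * (m * suc k) + 2 * D)
        ≤⟨ +-monoʳ-≤ (2 * (n * (2 + k))) (+-monoʳ-≤ (4 * (m * suc k)) (#crossings-bound (first ∘ A) k)) ⟩
      2 * (n * (2 + k)) + (4 * (m * suc k) + (2 * (m * ((m ∸ 1) * k)) + m * m)) ∎
      where
      open ≤-Reasoning
      D = #crossings (first ∘ A) k
      charges = ends (allFin n) + (starts (allFin n) + crosses (allFin n))
      double : ∀ x y d → 2 * (x + (y + (y + d))) ≡ 2 * x + (4 * y + 2 * d)
      double = solve-∀

  -- Monotonic representations

  orientations : ∀ {p q} → Path p q → List Orientation
  orientations []       = []
  orientations (s ∷ ss) = orientation s ∷ orientations ss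

  edges-ascending : ∀ {p q} (P : Path p q) → Ascending P → edges P ≡ edgesFrom p (orientations P)
  edges-ascending []           _         = refl
  edges-ascending (right ∷ ss) (_ , asc) = cong (_ ∷_) (edges-ascending ss asc)
  edges-ascending (up ∷ ss)    (_ , asc) = cong (_ ∷_) (edges-ascending ss asc)

  turns-orientations : ∀ {p q} (P : Path p q) → turns (orientations P) ≡ bends P
  turns-orientations []           = refl
  turns-orientations (s ∷ [])     = refl
  turns-orientations (s ∷ t ∷ ss) = cong (turn (orientation s) (orientation t) +_) (turns-orientations (t ∷ ss))

  Stairs : ℕ → GridPath → Set
  Stairs k P = ∃[ S ] (#turns S ≤ k ×
    (∀ {e} → e ∈ edgesOf S → e ∈ᴱ P) × (∀ {e} → e ∈ᴱ P → e ∈ edgesOf S))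

  as-staircase : ∀ P {k d} → Monotonic P → #bends P ≤ k → d ∈ᴱ P → Stairs k P
  -- An empty path contains no edge `d`.
  as-staircase (_ , _ , []) _ _ ()
  as-staircase (p , _ , P@(s ∷ ss)) ascending bends≤k _ =
    staircase p (orientation s) (orientations ss) ,
    subst (_≤ _) (sym (turns-orientations P)) bends≤k ,
    (λ {e} → subst (e ∈_) (sym eq)) , (λ {e} → subst (e ∈_) eq)
    where
    eq = edges-ascending P ascending

  -- With both classes nonempty, every path shares an edge with another one and so has a first step.
  representation-bound : ∀ {m n k} → HasMonotonicEPG k (K (suc m) (suc n)) →
    2 * (suc n * (2 * suc m)) ≤
    2 * (suc n * (2 + k)) + (4 * (suc m * suc k) + (2 * (suc m * (m * k)) + suc m * suc m))
  representation-bound {m} {n} {k} (R , good) = Total.total-bound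
    (proj₁ ∘ left-stairs) (proj₁ ∘ right-stairs)
    (λ {a} {b} e∈a e∈b → disjoint-left (in-path (left-stairs a) e∈a) (in-path (left-stairs b) e∈b))
    (λ {i} {j} e∈i e∈j → disjoint-right (in-path (right-stairs i) e∈i) (in-path (right-stairs j) e∈j))
    (proj₁ ∘ proj₂ ∘ left-stairs) (proj₁ ∘ proj₂ ∘ right-stairs)
    (λ a j → let e , e∈a , e∈j = shared a j in
      e , proj₂ (proj₂ (proj₂ (left-stairs a))) e∈a , proj₂ (proj₂ (proj₂ (right-stairs j))) e∈j)
    where
    open EPGRepresentation R

    shared : ∀ a j → ShareEdge (path (inj₁ a)) (path (inj₂ j))
    shared a j = Equivalence.to (adjacent (inj₁ a) (inj₂ j) λ ()) left-right

    left-stairs : ∀ a → Stairs k (path (inj₁ a))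
    left-stairs a = let mono , bends≤k = good (inj₁ a) ; _ , e∈a , _ = shared a Fin.zero in
      as-staircase (path (inj₁ a)) mono bends≤k e∈a

    right-stairs : ∀ j → Stairs k (path (inj₂ j))
    right-stairs j = let mono , bends≤k = good (inj₂ j) ; _ , _ , e∈j = shared Fin.zero j in
      as-staircase (path (inj₂ j)) mono bends≤k e∈j

    in-path : ∀ {P} (S : Stairs k P) {e} → e ∈ edgesOf (proj₁ S) → e ∈ᴱ P
    in-path (_ , _ , sound , _) = sound

    -- Distinct vertices of one class are not adjacent, so their paths share no edge.
    disjoint-left : ∀ {a b e} → e ∈ᴱ path (inj₁ a) → e ∈ᴱ path (inj₁ b) → a ≡ b
    disjoint-left {a} {b} e∈a e∈b with a Fin.≟ b
    ... | yes a≡b = a≡b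
    ... | no  a≢b with Equivalence.from (adjacent (inj₁ a) (inj₁ b) λ { refl → a≢b refl }) (_ , e∈a , e∈b)
    ...   | ()

    disjoint-right : ∀ {i j e} → e ∈ᴱ path (inj₂ i) → e ∈ᴱ path (inj₂ j) → i ≡ j
    disjoint-right {i} {j} e∈i e∈j with i Fin.≟ j
    ... | yes i≡j = i≡j
    ... | no  i≢j with Equivalence.from (adjacent (inj₂ i) (inj₂ j) λ { refl → i≢j refl }) (_ , e∈i , e∈j)
    ...   | ()

-- From natural numbers to rationals

module _ where
  import Data.Nat as ℕ
  open import Data.Integer using (+_; -[1+_]; +≤+; _+_; _*_; -_) renaming (_≤_ to _≤ᶻ_)
  open import Data.Integer.Properties using (pos-*; +-monoˡ-≤)
  open import Data.Integer.Tactic.RingSolver using (solve-∀)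

  cast₃ : ∀ a b c → + (a ℕ.* (b ℕ.* c)) ≡ + a * (+ b * + c)
  cast₃ a b c = trans (pos-* a (b ℕ.* c)) (cong (+ a *_) (pos-* b c))

  cast₄ : ∀ a b c d → + (a ℕ.* (b ℕ.* (c ℕ.* d))) ≡ + a * (+ b * (+ c * + d))
  cast₄ a b c d = trans (pos-* a (b ℕ.* (c ℕ.* d))) (cong (+ a *_) (cast₃ b c d))

  -- The two sides have the shape to which ≤ᵘ unfolds in the theorem, m being suc m there.
  numerators-bound : ∀ m n k →
    2 ℕ.* (n ℕ.* (2 ℕ.* suc m)) ≤
      2 ℕ.* (n ℕ.* (2 ℕ.+ k)) ℕ.+
        (4 ℕ.* (suc m ℕ.* suc k) ℕ.+ (2 ℕ.* (suc m ℕ.* (m ℕ.* k)) ℕ.+ suc m ℕ.* suc m)) →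
    + n * (((+ 2 * + suc m) * + 1 + (- + k) * + 1) * + 1 + -[1+ 1 ] * + 1) * + 2 ≤ᶻ
      (((+ k * (+ suc m * + 1 + -[1+ 0 ] * + 1) * + suc m) * + 2
          + (+ 1 * (+ suc m * + suc m)) * + 1) * + 1
        + (+ 2 * (+ k * + 1 + + 1 * + 1) * + suc m) * + 2) * + 1
  numerators-bound m n k bound =
    -- The term 2 n (2 + k) is subtracted on both sides; the rest is rearrangement.
    subst₂ _≤ᶻ_ (identityˡ (+ n) (+ m) (+ k)) (identityʳ (+ n) (+ m) (+ k))
      (+-monoˡ-≤ (- (+ 2 * (+ n * (+ 2 + + k)))) (subst₂ _≤ᶻ_ castˡ castʳ (+≤+ bound)))
    where
    castˡ = cast₄ 2 n 2 (suc m)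

    castʳ = cong₂ _+_ (cast₃ 2 n (2 ℕ.+ k)) (cong₂ _+_ (cast₃ 4 (suc m) (suc k))
      (cong₂ _+_ (cast₄ 2 (suc m) m k) (pos-* (suc m) (suc m))))

    -- The last factor `+ 2` is the denominator that `½` gives the other side; the factors `+ 1` are
    -- trivial denominators.
    identityˡ : ∀ n m k →
      + 2 * (n * (+ 2 * (+ 1 + m))) + (- (+ 2 * (n * (+ 2 + k)))) ≡
      n * (((+ 2 * (+ 1 + m)) * + 1 + (- k) * + 1) * + 1 + -[1+ 1 ] * + 1) * + 2
    identityˡ = solve-∀

    identityʳ : ∀ n m k →
      (+ 2 * (n * (+ 2 + k)) +
        (+ 4 * ((+ 1 + m) * (+ 1 + k)) +
          (+ 2 * ((+ 1 + m) * (m * k)) + (+ 1 + m) * (+ 1 + m)))) +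
        (- (+ 2 * (n * (+ 2 + k)))) ≡
      (((k * ((+ 1 + m) * + 1 + -[1+ 0 ] * + 1) * (+ 1 + m)) * + 2
          + (+ 1 * ((+ 1 + m) * (+ 1 + m))) * + 1) * + 1
        + (+ 2 * (k * + 1 + + 1 * + 1) * (+ 1 + m)) * + 2) * + 1
    identityʳ = solve-∀

open import Data.Rational.Unnormalised using (_+_; _-_; _*_; 1ℚᵘ; ½; *≤*) renaming (_≤_ to _≤ᵘ_)

lemma2p5 : (m n k : ℕ) → 3 ≤ m → m ≤ n → HasMonotonicEPG k (K m n) →
    fromℕ n * (fromℕ 2 * fromℕ m - fromℕ k - fromℕ 2)
      ≤ᵘ fromℕ k * (fromℕ m - 1ℚᵘ) * fromℕ m
          + ½ * (fromℕ m * fromℕ m)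
          + fromℕ 2 * (fromℕ k + 1ℚᵘ) * fromℕ m
lemma2p5 (suc m) (suc n) k _ _ representation =
  -- `3 ≤ m` and `m ≤ n` leave only successors, and `*≤*` asks for the cross-multiplied inequality
  -- of integers.
  *≤* (numerators-bound m (suc n) k (representation-bound representation))
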